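{- A graph $G$ is $\gamma_g'$-perfect if and only if it is a disjoint union of cliques (i.e. every connected component of $G$ is a complete graph).
   Context: Graphs are finite, simple, undirected, with at least one vertex, not necessarily connected. $\gamma(G)$ is the domination number of $G$. Domination game on $G$: Dominator and Staller alternately select vertices; each selected vertex must dominate (i.e. contain in its closed neighborhood) at least one vertex not dominated by the previously selected vertices. The game ends when no legal move exists. Dominator wants to minimize and Staller to maximize the total number of moves. $\gamma_g'(G)$ is the number of moves under optimal play when Staller starts. $G$ is $\gamma_g'$-perfect if every induced subgraph $F$ of $G$ satisfies $\gamma_g'(F)=\gamma(F)$. -}

module Defs where

open import Data.Fin using (Fin)
open import Data.Fin.Properties using (_≟_; all?; any?)
open import Data.Fin.Subset using (Subset; inside; outside; _∈_; ∣_∣)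
open import Data.Fin.Subset.Properties using (_∈?_)
open import Data.List using (List; []; _∷_; _++_; map; filter; allFin)
open import Data.List.Extrema.Nat using (min; max)
open import Data.List.Relation.Unary.Any as Any using (Any)
open import Data.Nat using (ℕ; zero; suc; NonZero)
open import Data.Product using (∃-syntax; _×_)
open import Data.Sum using (_⊎_)
open import Data.Vec as Vec using ()
open import Function using (_↣_; module Injection)
open import Level using (0ℓ)
open import Relation.Binary using (Rel; Symmetric; Irreflexive; Decidable)
open import Relation.Binary.Construct.Closure.ReflexiveTransitive using (Star)
open import Relation.Binary.PropositionalEquality using (_≡_; _≢_; cong)
open import Relation.Nullary using (¬_; ¬?; _×-dec_; _⊎-dec_)
import Relation.Unary as U

record Graph (n : ℕ) : Set₁ where
  field
    Adj    : Rel (Fin n) 0ℓ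
    adj?   : Decidable Adj
    sym    : Symmetric Adj
    irrefl : Irreflexive _≡_ Adj

-- Up to the naming of its vertices, the induced subgraphs of G with m
-- vertices are exactly the pullbacks of G along injections Fin m ↣ Fin n.
induced : ∀ {m n} → Graph n → Fin m ↣ Fin n → Graph m
induced G f = record
  { Adj    = λ u v → Adj (to u) (to v)
  ; adj?   = λ u v → adj? (to u) (to v)
  ; sym    = sym
  ; irrefl = λ u≡v → irrefl (cong to u≡v)
  }
  where
  open Graph G
  open Injection f using (to)

subsets : ∀ n → List (Subset n)
subsets zero    = Vec.[] ∷ []
subsets (suc n) =
  map (outside Vec.∷_) (subsets n) ++ map (inside Vec.∷_) (subsets n)

data Player : Set where
  Dominator Staller : Player

opponent : Player → Player
opponent Dominator = Staller
opponent Staller   = Dominator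

-- The player to move picks among the final lengths reachable by the legal
-- moves.  The empty list means that no legal move exists: the game is over
-- and no further moves are counted.
optimum : Player → List ℕ → ℕ
optimum _         []       = 0
optimum Dominator (x ∷ xs) = min x xs
optimum Staller   (x ∷ xs) = max x xs

module _ {n : ℕ} (G : Graph n) where
  open Graph G

  -- u lies in the closed neighbourhood of v.
  Dominates : Rel (Fin n) 0ℓ
  Dominates v u = v ≡ u ⊎ Adj v u

  dominates? : Decidable Dominates
  dominates? v u = (v ≟ u) ⊎-dec adj? v u

  IsDominating : Subset n → Set
  IsDominating S = ∀ u → ∃[ v ] (v ∈ S × Dominates v u)

  isDominating? : U.Decidable IsDominating
  isDominating? S = all? λ u → any? λ v → (v ∈? S) ×-dec dominates? v u

  -- Domination number.  The default value n of the minimum is the size of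
  -- the full vertex set, which is always dominating.
  γ : ℕ
  γ = min n (map ∣_∣ (filter isDominating? (subsets n)))

  -- A position of the game is the list of the vertices selected so far.
  Legal : List (Fin n) → Fin n → Set
  Legal selected v =
    ∃[ u ] (Dominates v u × ¬ Any (λ w → Dominates w u) selected)

  legal? : ∀ selected → U.Decidable (Legal selected)
  legal? selected v =
    any? λ u → dominates? v u ×-dec ¬? (Any.any? (λ w → dominates? w u) selected)

  -- Number of moves still to be made under optimal play, where the first
  -- argument is the player to move.  The ℕ argument bounds the number of
  -- these moves and serves only to make the recursion structural.
  remainingMoves : Player → ℕ → List (Fin n) → ℕ
  remainingMoves p zero    selected = 0
  remainingMoves p (suc k) selected =
    optimum p (map (λ v → suc (remainingMoves (opponent p) k (v ∷ selected)))
                   (filter (legal? selected) (allFin n)))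

  -- The Staller-start game domination number.  Every move dominates a new
  -- vertex, so every play has at most n moves and the bound n is never
  -- what ends the game.
  γg′ : ℕ
  γg′ = remainingMoves Staller n []

  Component : Fin n → U.Pred (Fin n) 0ℓ
  Component w = Star Adj w

  IsClique : U.Pred (Fin n) 0ℓ → Set
  IsClique P = ∀ {u v} → P u → P v → u ≢ v → Adj u v

  IsDisjointUnionOfCliques : Set
  IsDisjointUnionOfCliques = ∀ w → IsClique (Component w)

-- Graphs have at least one vertex, hence NonZero m.
Isγg′Perfect : ∀ {n} → Graph n → Set
Isγg′Perfect {n} G =
  ∀ {m} .{{_ : NonZero m}} (f : Fin m ↣ Fin n) →
  γg′ (induced G f) ≡ γ (induced G f)

{-# OPTIONS --safe #-}
-- A graph is a disjoint union of cliques iff it has no induced path on three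
-- vertices.  On such a path Staller opens with an endpoint, which forces a
-- second move although the middle vertex dominates everything, so γg′ ≥ 2 and
-- γ = 1.  Conversely, if adjacency is transitive then a legal move is never
-- dominated by an earlier one, hence the selected vertices are always
-- independent and the final selection is moreover dominating.  An independent
-- set is no larger than any dominating set, since a vertex dominates at most
-- one member of it; so every play, optimal or not, ends after γ moves.
module Submission where

open import Defs
open import Data.Fin using (Fin)
open import Data.Fin.Patterns using (0F; 1F; 2F)
open import Data.Fin.Properties using (_≟_)
open import Data.Fin.Subset using (Subset; inside; outside; _∈_; ∣_∣; ⁅_⁆; _∪_; ⋃; _-_)
open import Data.Fin.Subset.Properties
  using (x∈p⇒∣p-x∣<∣p∣; x∈p∧x≢y⇒x∈p-y; x∈p∪q⁺; x∈⁅x⁆; ∣⁅x⁆∣≡1; ∣⊥∣≡0; ∈⊤; ∣⊤∣≡n)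
open import Data.List using (List; []; _∷_; map; filter; allFin; length)
open import Data.List.Extrema.Nat using (argmin-all; argmax-all; min≤xs; v≤min⁺; ⊥≤max; xs≤max)
open import Data.List.Membership.Propositional using (find) renaming (_∈_ to _∈ˡ_)
open import Data.List.Membership.Propositional.Properties
  using (∈-map⁺; ∈-filter⁺; ∈-allFin; ∈-++⁺ˡ; ∈-++⁺ʳ)
open import Data.List.Relation.Unary.All as All using (All; []; _∷_)
open import Data.List.Relation.Unary.All.Properties using (gmap⁺; all-filter; ¬Any⇒All¬)
open import Data.List.Relation.Unary.AllPairs using (AllPairs; []; _∷_)
open import Data.List.Relation.Unary.Any as Any using (Any; here; there)
open import Data.Nat using (ℕ; zero; suc; NonZero; _+_; _≤_; z≤n; s≤s)
open import Data.Nat.Properties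
  using (≤-refl; ≤-reflexive; ≤-trans; ≤-antisym; +-suc; +-identityʳ; +-monoʳ-≤; +-monoˡ-≤;
         m≤n⇒m≤1+n; <-irrefl; module ≤-Reasoning)
open import Data.Product using (∃-syntax; _×_; _,_)
open import Data.Sum using (inj₁; inj₂)
open import Data.Vec as Vec using (Vec; lookup)
import Data.Vec.Relation.Unary.All as VecAll
import Data.Vec.Relation.Unary.AllPairs as VecAllPairs
open import Data.Vec.Relation.Unary.Unique.Propositional using (Unique)
open import Data.Vec.Relation.Unary.Unique.Propositional.Properties using (lookup-injective)
open import Function using (_⇔_; _↣_; mk⇔; mk↣; id; _∘_; module Injection)
open import Relation.Binary using (Transitive; Symmetric)
open import Relation.Binary.Construct.Closure.ReflexiveTransitive using (Star; ε; _◅_; _◅◅_; reverse)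
open import Relation.Binary.PropositionalEquality
  using (_≡_; _≢_; refl; sym; trans)
open import Relation.Nullary using (¬_; yes; no; contradiction)
open import Relation.Nullary.Decidable using (decidable-stable)
open import Relation.Unary using (Pred)

∈-subsets : ∀ {n} (S : Subset n) → S ∈ˡ subsets n
∈-subsets Vec.[] = here refl
∈-subsets (outside Vec.∷ S) = ∈-++⁺ˡ (∈-map⁺ (outside Vec.∷_) (∈-subsets S))
∈-subsets {suc n} (inside Vec.∷ S) =
  ∈-++⁺ʳ (map (outside Vec.∷_) (subsets n)) (∈-map⁺ (inside Vec.∷_) (∈-subsets S))

∣p∪q∣≤∣p∣+∣q∣ : ∀ {n} (p q : Subset n) → ∣ p ∪ q ∣ ≤ ∣ p ∣ + ∣ q ∣
∣p∪q∣≤∣p∣+∣q∣ Vec.[] Vec.[] = z≤n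
∣p∪q∣≤∣p∣+∣q∣ (outside Vec.∷ p) (outside Vec.∷ q) = ∣p∪q∣≤∣p∣+∣q∣ p q
∣p∪q∣≤∣p∣+∣q∣ (outside Vec.∷ p) (inside  Vec.∷ q) =
  ≤-trans (s≤s (∣p∪q∣≤∣p∣+∣q∣ p q)) (≤-reflexive (sym (+-suc ∣ p ∣ ∣ q ∣)))
∣p∪q∣≤∣p∣+∣q∣ (inside  Vec.∷ p) (outside Vec.∷ q) = s≤s (∣p∪q∣≤∣p∣+∣q∣ p q)
∣p∪q∣≤∣p∣+∣q∣ (inside  Vec.∷ p) (inside  Vec.∷ q) =
  s≤s (≤-trans (∣p∪q∣≤∣p∣+∣q∣ p q) (+-monoʳ-≤ ∣ p ∣ (m≤n⇒m≤1+n ≤-refl)))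

module _ {n : ℕ} where

  fromList : List (Fin n) → Subset n
  fromList = ⋃ ∘ map ⁅_⁆

  ∈-fromList : ∀ {v vs} → v ∈ˡ vs → v ∈ fromList vs
  ∈-fromList {v} (here refl)  = x∈p∪q⁺ (inj₁ (x∈⁅x⁆ v))
  ∈-fromList     (there v∈vs) = x∈p∪q⁺ (inj₂ (∈-fromList v∈vs))

  ∣fromList∣≤length : ∀ vs → ∣ fromList vs ∣ ≤ length vs
  ∣fromList∣≤length []       = ≤-reflexive (∣⊥∣≡0 n)
  ∣fromList∣≤length (v ∷ vs) = begin
    ∣ ⁅ v ⁆ ∪ fromList vs ∣     ≤⟨ ∣p∪q∣≤∣p∣+∣q∣ ⁅ v ⁆ (fromList vs) ⟩
    ∣ ⁅ v ⁆ ∣ + ∣ fromList vs ∣ ≤⟨ +-monoˡ-≤ _ (≤-reflexive (∣⁅x⁆∣≡1 v)) ⟩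
    suc ∣ fromList vs ∣         ≤⟨ s≤s (∣fromList∣≤length vs) ⟩
    suc (length vs)             ∎
    where open ≤-Reasoning

-- Minimum and maximum both return a member of the list, so a property of every outcome holds for
-- the optimum whichever player moves. Only the value 0 given to the empty list needs its own
-- hypothesis.
optimum-all : ∀ {ℓ} (P : Pred ℕ ℓ) p {xs} → (xs ≡ [] → P 0) → All P xs → P (optimum p xs)
optimum-all _ p         {[]}    P0 _          = P0 refl
optimum-all P Dominator {_ ∷ _} _  (Px ∷ Pxs) = argmin-all id {P = P} Px Pxs
optimum-all P Staller   {_ ∷ _} _  (Px ∷ Pxs) = argmax-all id {P = P} Px Pxs

≤-optimum-Staller : ∀ {x xs} → x ∈ˡ xs → x ≤ optimum Staller xs
≤-optimum-Staller {xs = y ∷ ys} (here refl)  = ⊥≤max y ys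
≤-optimum-Staller {xs = y ∷ ys} (there x∈ys) = All.lookup (xs≤max y ys) x∈ys

∉[] : ∀ {A : Set} {x : A} {xs} → x ∈ˡ xs → xs ≢ []
∉[] () refl

module _ {n : ℕ} (G : Graph n) where

  P₃-Free : Set
  P₃-Free = ∀ {u v w} → Graph.Adj G u v → Graph.Adj G v w → u ≢ w → Graph.Adj G u w

  -- Stated with `Dominates` rather than adjacency, so that repetitions are excluded too and
  -- `length` counts distinct vertices.
  Independent : List (Fin n) → Set
  Independent = AllPairs (λ u v → ¬ Dominates G u v)

  γ≤∣dominating∣ : ∀ {S} → IsDominating G S → γ G ≤ ∣ S ∣
  γ≤∣dominating∣ {S} dom = All.lookup (min≤xs n _)
    (∈-map⁺ ∣_∣ (∈-filter⁺ (isDominating? G) (∈-subsets S) dom))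

  ≤-γ : ∀ {k} → (∀ {S} → IsDominating G S → k ≤ ∣ S ∣) → k ≤ γ G
  ≤-γ k≤ = v≤min⁺
    -- The default value `n` of the minimum must be bounded as well; it is the size of the full
    -- vertex set, which dominates.
    (≤-trans (k≤ λ u → u , ∈⊤ , inj₁ refl) (≤-reflexive (∣⊤∣≡n n)))
    (gmap⁺ k≤ (all-filter (isDominating? G) (subsets n)))

  γ≤n : γ G ≤ n
  γ≤n = ≤-trans (γ≤∣dominating∣ λ u → u , ∈⊤ , inj₁ refl) (≤-reflexive (∣⊤∣≡n n))

  γ≤length : ∀ {vs} → (∀ u → Any (λ v → Dominates G v u) vs) → γ G ≤ length vs
  γ≤length {vs} dom = ≤-trans (γ≤∣dominating∣ fromList-dominating) (∣fromList∣≤length vs)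
    where
    fromList-dominating : IsDominating G (fromList vs)
    fromList-dominating u with v , v∈vs , v▷u ← find (dom u) = v , ∈-fromList v∈vs , v▷u

  -- Definitionally the list whose optimum is `remainingMoves G p (suc k) selected`, so facts about
  -- `optimum` apply without rewriting.
  nextLengths : Player → ℕ → List (Fin n) → List ℕ
  nextLengths p k selected =
    map (λ v → suc (remainingMoves G (opponent p) k (v ∷ selected)))
        (filter (legal? G selected) (allFin n))

  ∈-nextLengths : ∀ p k {selected v} → Legal G selected v →
                  suc (remainingMoves G (opponent p) k (v ∷ selected)) ∈ˡ nextLengths p k selected
  ∈-nextLengths p k {selected} {v} legal =
    ∈-map⁺ _ (∈-filter⁺ (legal? G selected) (∈-allFin v) legal)

  remainingMoves-positive : ∀ p k {selected v} → Legal G selected v →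
                            1 ≤ remainingMoves G p (suc k) selected
  remainingMoves-positive p k {selected} legal = optimum-all (1 ≤_) p
    (λ eq → contradiction eq (∉[] (∈-nextLengths p k legal)))
    (gmap⁺ (λ _ → s≤s z≤n) (all-filter (legal? G selected) (allFin n)))

  Dominates-sym : Symmetric (Dominates G)
  Dominates-sym (inj₁ u≡v) = inj₁ (sym u≡v)
  Dominates-sym (inj₂ uv)  = inj₂ (Graph.sym G uv)

  module _ (p₃-free : P₃-Free) where

    Dominates-trans : Transitive (Dominates G)
    Dominates-trans (inj₁ refl) vw          = vw
    Dominates-trans (inj₂ uv)   (inj₁ refl) = inj₂ uv
    Dominates-trans {u} {v} {w} (inj₂ uv) (inj₂ vw) with u ≟ w
    ... | yes u≡w = inj₁ u≡w
    ... | no  u≢w = inj₂ (p₃-free uv vw u≢w)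

    connected⇒dominates : ∀ {u v} → Star (Graph.Adj G) u v → Dominates G u v
    connected⇒dominates ε         = inj₁ refl
    connected⇒dominates (uv ◅ vw) = Dominates-trans (inj₂ uv) (connected⇒dominates vw)

    -- Induction on `vs`, deleting from `S` a dominator `s` of the first vertex. If `s` also
    -- dominated a later vertex, transitivity through `s` would contradict independence, so the
    -- later vertices keep their dominators. Domination is asked of `vs` alone because `S - s` may
    -- fail to dominate the first vertex.
    independent≤dominating : ∀ {vs} S → Independent vs →
      All (λ u → ∃[ s ] (s ∈ S × Dominates G s u)) vs → length vs ≤ ∣ S ∣
    independent≤dominating S [] [] = z≤n
    independent≤dominating S (v⋫vs ∷ indep) ((s , s∈S , s▷v) ∷ dom) =
      ≤-trans (s≤s (independent≤dominating (S - s) indep (All.zipWith keep (v⋫vs , dom))))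
              (x∈p⇒∣p-x∣<∣p∣ s∈S)
      where
      keep : ∀ {u} → ¬ Dominates G _ u × ∃[ t ] (t ∈ S × Dominates G t u) →
             ∃[ t ] (t ∈ S - s × Dominates G t u)
      keep (v⋫u , t , t∈S , t▷u) =
        t , x∈p∧x≢y⇒x∈p-y t∈S (λ { refl → v⋫u (Dominates-trans (Dominates-sym s▷v) t▷u) }) , t▷u

    independent≤γ : ∀ {vs} → Independent vs → length vs ≤ γ G
    independent≤γ indep =
      ≤-γ λ {S} dom → independent≤dominating S indep (All.universal dom _)

    -- An earlier `w` dominated by `v` would, by symmetry and transitivity, dominate the vertex `u`
    -- that `v` newly dominates.
    legal⇒independent : ∀ {selected v} → Independent selected → Legal G selected v →
                        Independent (v ∷ selected)
    legal⇒independent indep (u , v▷u , undominated) =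
      All.map (λ w⋫u v▷w → w⋫u (Dominates-trans (Dominates-sym v▷w) v▷u))
              (¬Any⇒All¬ _ undominated)
      ∷ indep

    -- Independence gives one inequality. For the other, an undominated vertex would itself be a
    -- legal move, so the selection dominates.
    finished⇒length≡γ : ∀ {selected} → Independent selected → (∀ v → ¬ Legal G selected v) →
                        length selected ≡ γ G
    finished⇒length≡γ {selected} indep finished =
      ≤-antisym (independent≤γ indep) (γ≤length λ u →
        decidable-stable (Any.any? (λ w → dominates? G w u) selected)
          (λ undominated → finished u (u , inj₁ refl , undominated)))

    -- The invariant of play, for any independent position and either player. The hypothesis on `n`
    -- ensures that the bound `k` never cuts the game short.
    remainingMoves+length≡γ : ∀ p k {selected} → Independent selected → n ≤ k + length selected →
                              remainingMoves G p k selected + length selected ≡ γ G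
    remainingMoves+length≡γ p zero indep n≤length =
      finished⇒length≡γ indep λ v legal →
        -- One more legal move would give `suc (length selected) ≤ γ G ≤ n ≤ length selected`.
        <-irrefl refl (≤-trans (independent≤γ (legal⇒independent indep legal))
                               (≤-trans γ≤n n≤length))
    remainingMoves+length≡γ p (suc k) {selected} indep n≤ =
      optimum-all (λ x → x + length selected ≡ γ G) p
        -- An empty list of outcomes means that no move is legal, so the default 0 is the true
        -- number of remaining moves.
        (λ eq → finished⇒length≡γ indep λ v legal → ∉[] (∈-nextLengths p k legal) eq)
        (gmap⁺ afterMove (all-filter (legal? G selected) (allFin n)))
      where
      afterMove : ∀ {v} → Legal G selected v →
        suc (remainingMoves G (opponent p) k (v ∷ selected)) + length selected ≡ γ G
      afterMove legal = trans (sym (+-suc _ (length selected)))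
        (remainingMoves+length≡γ (opponent p) k (legal⇒independent indep legal)
          (≤-trans n≤ (≤-reflexive (sym (+-suc k (length selected))))))

    P₃-Free⇒γg′≡γ : γg′ G ≡ γ G
    P₃-Free⇒γg′≡γ = trans (sym (+-identityʳ _))
      (remainingMoves+length≡γ Staller n [] (≤-reflexive (sym (+-identityʳ n))))

  disjointUnionOfCliques⇒P₃-Free : IsDisjointUnionOfCliques G → P₃-Free
  disjointUnionOfCliques⇒P₃-Free cliques {u} uv vw = cliques u ε (uv ◅ vw ◅ ε)

  P₃-Free⇒disjointUnionOfCliques : P₃-Free → IsDisjointUnionOfCliques G
  P₃-Free⇒disjointUnionOfCliques p₃-free w wu wv u≢v
    -- Both walks start at `w`; reversing the first joins them into a walk from `u` to `v`.
    with connected⇒dominates p₃-free (reverse (Graph.sym G) wu ◅◅ wv)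
  ... | inj₁ u≡v = contradiction u≡v u≢v
  ... | inj₂ uv  = uv

induced-P₃-Free : ∀ {m n} (G : Graph n) (f : Fin m ↣ Fin n) → P₃-Free G → P₃-Free (induced G f)
induced-P₃-Free G f p₃-free uv vw u≢w = p₃-free uv vw (u≢w ∘ Injection.injective f)

inducedP₃⇒γg′≢γ : (H : Graph 3) → let open Graph H in
  Adj 0F 1F → Adj 1F 2F → ¬ Adj 0F 2F → γg′ H ≢ γ H
inducedP₃⇒γg′≢γ H 01F 12F ¬02F γg′≡γ =
  -- The chain ends in `2 ≤ ∣ ⁅ 1F ⁆ ∣`, where the right side computes to 1.
  <-irrefl refl (≤-trans 2≤γg′ (≤-trans (≤-reflexive γg′≡γ) (γ≤∣dominating∣ H centre)))
  where
  centre : IsDominating H ⁅ 1F ⁆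
  centre 0F = 1F , x∈⁅x⁆ 1F , inj₂ (Graph.sym H 01F)
  centre 1F = 1F , x∈⁅x⁆ 1F , inj₁ refl
  centre 2F = 1F , x∈⁅x⁆ 1F , inj₂ 12F

  2≤γg′ : 2 ≤ γg′ H
  2≤γg′ = ≤-trans
    -- After Staller opens with `0F`, the bound 3 has dropped to 2, and `2F` is legal because it is
    -- itself still undominated.
    (s≤s (remainingMoves-positive H Dominator 1 {0F ∷ []} {2F}
      (2F , inj₁ refl , λ { (here (inj₂ 02F)) → ¬02F 02F })))
    (≤-optimum-Staller (∈-nextLengths H Staller 2 {[]} {0F} (0F , inj₁ refl , λ ())))

perfect⇒P₃-Free : ∀ {n} (G : Graph n) → Isγg′Perfect G → P₃-Free G
perfect⇒P₃-Free {n} G perfect {u} {v} {w} uv vw u≢w = decidable-stable (Graph.adj? G u w) λ ¬uw →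
  -- `lookup` computes on `0F`, `1F` and `2F`, so the facts about `u`, `v` and `w` are already facts
  -- about the induced graph.
  inducedP₃⇒γg′≢γ (induced G path) uv vw ¬uw (perfect path)
  where
  adj⇒≢ : ∀ {x y} → Graph.Adj G x y → x ≢ y
  adj⇒≢ xy x≡y = Graph.irrefl G x≡y xy

  vertices : Vec (Fin n) 3
  vertices = u Vec.∷ v Vec.∷ w Vec.∷ Vec.[]

  unique : Unique vertices
  unique = (adj⇒≢ uv VecAll.∷ u≢w VecAll.∷ VecAll.[])
    VecAllPairs.∷ (adj⇒≢ vw VecAll.∷ VecAll.[])
    VecAllPairs.∷ VecAll.[]
    VecAllPairs.∷ VecAllPairs.[]

  path : Fin 3 ↣ Fin n
  path = mk↣ {to = lookup vertices} (lookup-injective unique _ _)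

P₃-Free⇒perfect : ∀ {n} (G : Graph n) → P₃-Free G → Isγg′Perfect G
P₃-Free⇒perfect G p₃-free f = P₃-Free⇒γg′≡γ (induced G f) (induced-P₃-Free G f p₃-free)

proposition5p1 : ∀ (n : ℕ) .{{_ : NonZero n}} (G : Graph n) →
    Isγg′Perfect G ⇔ IsDisjointUnionOfCliques G
proposition5p1 n G = mk⇔ {A = Isγg′Perfect G}
  (λ perfect → P₃-Free⇒disjointUnionOfCliques G (perfect⇒P₃-Free G perfect))
  (λ cliques → P₃-Free⇒perfect G (disjointUnionOfCliques⇒P₃-Free G cliques))
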